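{- Let $\mathcal{P}$ be a set of inductively defined predicates and let $P \in \mathcal{P}$, with parameters $(\vec{\alpha},\vec{\beta},\vec{\xi})$, be syntactically compositional. Then $P$ is semantically compositional, i.e. for every pair $\vec{\gamma}=(\gamma_1,\gamma_2)$ of a location variable and a data variable, the entailment $$\exists \vec{\beta}.\ P(\vec{\alpha},\vec{\beta},\vec{\xi}) \ast P(\vec{\beta},\vec{\gamma},\vec{\xi}) \Rightarrow P(\vec{\alpha},\vec{\gamma},\vec{\xi})$$ holds, that is, every stack–heap pair $(s,h)$ satisfying the left-hand side also satisfies the right-hand side.
   Context: Separation logic setting: location variables (interpreted in a set $\mathbb{L}$ of locations, with a constant ${\sf nil}$) and data variables (interpreted as data values, multisets of values, etc.); a set $\mathcal{F}$ of pointer fields and $\mathcal{D}$ of data fields. A state is a pair $(s,h)$: a stack $s$ assigning values to variables, and a heap $h$, a finite partial function mapping pairs (location, pointer field) to locations and pairs (location, data field) to data values. Formulas: pure formulas $\Pi$ (conjunctions of (dis)equalities of location variables and constraints $\Delta$ over data variables in some decidable theory), spatial formulas $\Sigma ::= \mathtt{emp} \mid E\mapsto\rho \mid Q(E,\vec{F}) \mid \Sigma\ast\Sigma$, and formulas built as $\Pi\land\Sigma$, disjunction and existential quantification. $\mathtt{emp}$ holds iff the heap is empty; $E\mapsto\{(f_i,x_i)\}_{i\in I}$ holds iff the heap is defined exactly on location $s(E)$ with fields $f_i$ and $h(s(E),f_i)=s(x_i)$; $\Sigma_1\ast\Sigma_2$ holds iff the heap splits into two domain-disjoint parts satisfying $\Sigma_1$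 and $\Sigma_2$ respectively. Each predicate $Q\in\mathcal{P}$ is defined by a finite set of rules $Q(E,\vec{F}) ::= \exists\vec{Z}.\ \Pi\land\Sigma$, with least-fixed-point semantics. A rule is a base rule if $\Sigma$ contains no predicate atoms, otherwise inductive. Every inductive rule $Q(E,\vec F)::=\exists \vec Z.\Pi\land\Sigma_1\ast\Sigma_2$ satisfies: $\Sigma_1$ consists only of points-to atoms, contains a unique points-to atom with source $E$, contains all location variables of $\vec Z$, and its Gaifman graph is a connected DAG in which every vertex is reachable from $E$; $\Sigma_2$ consists only of predicate atoms $Q'(Z,\vec{Z'})$ with $Z$ a vertex of that graph without outgoing arcs. Syntactic compositionality: $P$ has parameters $(\vec\alpha,\vec\beta,\vec\xi)$ with source parameters $\vec\alpha=(\alpha_1,\alpha_2)=(E,C)$, hole parameters $\vec\beta=(\beta_1,\beta_2)=(F,H)$ ($E,F$ location variables, $C,H$ data variables) and static parameters $\vec\xi$. $P$ is syntactically compositional if its definition has exactly one base rule, namely $P(\vec\alpha,\vec\beta,\vec\xi)::=\alpha_1=\beta_1\land\alpha_2=\beta_2\land\mathtt{emp}$, and at least one inductive rule, and every inductive rule has the form $P(\vec\alpha,\vec\beta,\vec\xi)::=\exists\vec Z.\ \Pi\land\Sigma_1\ast\Sigma_2\ast P(\vec\gamma,\vec\beta,\vec\xi)$ where $\Sigma_1$ is a nonempty separating conjunction of points-to atoms, $\Sigma_2$ is a (possibly empty) separating conjunction of predicate atoms (possibly including $P$ atoms), $\vec\gamma$ consists of variables of $\vec Z$, and the variables of $\vec\beta$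 do not occur in $\Pi$, $\Sigma_1$, $\Sigma_2$ or $\vec\gamma$ (and the rule satisfies the general root/connectedness conditions above). -}

module Defs where

open import Data.Fin using (Fin)
open import Data.List using (List; []; _∷_; _++_; length; concatMap)
import Data.List as List
open import Data.List.Membership.Propositional using (_∈_; _∉_)
open import Data.List.Membership.Propositional.Properties using (∈-++⁺ˡ; ∈-++⁺ʳ)
open import Data.List.Relation.Binary.Permutation.Propositional using (_↭_)
open import Data.List.Relation.Unary.All as All using (All; []; _∷_)
import Data.List.Relation.Unary.All.Properties as All
open import Data.List.Relation.Unary.Any using (Any; here; there)
open import Data.Maybe using (Maybe; just; nothing; Is-just; _<∣>_)
open import Data.Product using (Σ; ∃; ∃!; _×_; _,_; proj₁; proj₂)
open import Data.Sum using (_⊎_; inj₁; inj₂)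
open import Function.Bundles using (_⇔_)
open import Relation.Binary.Construct.Closure.Equivalence using (EqClosure)
open import Relation.Binary.Construct.Closure.ReflexiveTransitive using (Star)
open import Relation.Binary.Construct.Closure.Transitive using (TransClosure)
open import Relation.Binary.PropositionalEquality using (_≡_; _≢_; refl; sym; subst)
open import Relation.Nullary using (¬_; Dec)

-- `Constraint Δ` is the type of formulas of the theory whose free variables
-- are x₁ , … , xₖ of the sorts listed in Δ.
record DataTheory : Set₁ where
  field
    DataSort     : Set
    Value        : DataSort → Set
    Constraint   : List DataSort → Set
    _⊨ᵈ_         : ∀ {Δ} → All Value Δ → Constraint Δ → Set
    satisfiable? : ∀ {Δ} (c : Constraint Δ) → Dec (∃ λ v → v ⊨ᵈ c)
    equal        : ∀ δ → Constraint (δ ∷ δ ∷ [])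
    equal-⇔      : ∀ {δ} {x y : Value δ} → ((x ∷ y ∷ []) ⊨ᵈ equal δ) ⇔ (x ≡ y)

record Vocabulary : Set₁ where
  field
    theory   : DataTheory
  open DataTheory theory public
  field
    Loc      : Set
    nilₗ     : Loc
    PtrField : Set
    DatField : Set
    datSort  : DatField → DataSort

  data Sort : Set where
    loc : Sort
    dat : DataSort → Sort

  Val : Sort → Set
  Val loc     = Loc
  Val (dat δ) = Value δ

  Field : Set
  Field = PtrField ⊎ DatField

  fieldSort : Field → Sort
  fieldSort (inj₁ _) = loc
  fieldSort (inj₂ d) = dat (datSort d)

  -- Contexts list the sorts of the variables in scope; `σ ∈ Γ` is the type of
  -- variables of sort σ.
  Ctx : Set
  Ctx = List Sort

  Stack : Ctx → Set
  Stack = All Val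

  record Heap : Set where
    field
      at     : (ℓ : Loc) (f : Field) → Maybe (Val (fieldSort f))
      finite : ∃ λ (cells : List (Loc × Field)) →
                 ∀ {ℓ f} → Is-just (at ℓ f) → (ℓ , f) ∈ cells
  open Heap public

  IsEmpty : Heap → Set
  IsEmpty h = ∀ ℓ f → at h ℓ f ≡ nothing

  record Split (h h₁ h₂ : Heap) : Set where
    field
      disjoint : ∀ ℓ f → ¬ (Is-just (at h₁ ℓ f) × Is-just (at h₂ ℓ f))
      union    : ∀ ℓ f → at h ℓ f ≡ (at h₁ ℓ f <∣> at h₂ ℓ f)

-- The location parameter that comes first in every predicate is left out of
-- `rest`.
record PredicateSignature (V : Vocabulary) : Set₁ where
  open Vocabulary V
  field
    Pred : Set
    rest : Pred → List Sort

  params : Pred → Ctx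
  params Q = loc ∷ rest Q

module Logic (V : Vocabulary) (S : PredicateSignature V) where
  open Vocabulary V
  open PredicateSignature S

  data Term (Γ : Ctx) : Sort → Set where
    var : ∀ {σ} → σ ∈ Γ → Term Γ σ
    nil : Term Γ loc

  data Literal (Γ : Ctx) : Set where
    _≐_ : Term Γ loc → Term Γ loc → Literal Γ
    _≠_ : Term Γ loc → Term Γ loc → Literal Γ
    con : ∀ {Δ} → Constraint Δ → All (λ δ → dat δ ∈ Γ) Δ → Literal Γ

  Pure : Ctx → Set
  Pure Γ = List (Literal Γ)

  record PointsTo (Γ : Ctx) : Set where
    constructor _↦_
    field
      source : loc ∈ Γ
      cells  : List (∃ λ f → Term Γ (fieldSort f))
  open PointsTo public

  record PredAtom (Γ : Ctx) : Set where
    constructor _⟨_⟩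
    field
      name : Pred
      args : All (Term Γ) (params name)
  open PredAtom public

  infixr 6 _∗_

  data Spatial (Γ : Ctx) : Set where
    emp : Spatial Γ
    pto : PointsTo Γ → Spatial Γ
    prd : PredAtom Γ → Spatial Γ
    _∗_ : Spatial Γ → Spatial Γ → Spatial Γ

  data Formula (Γ : Ctx) : Set where
    _∧_ : Pure Γ → Spatial Γ → Formula Γ
    _∨_ : Formula Γ → Formula Γ → Formula Γ
    ex  : ∀ σ → Formula (σ ∷ Γ) → Formula Γ

  pointsTos : ∀ {Γ} → Spatial Γ → List (PointsTo Γ)
  pointsTos emp       = []
  pointsTos (pto p)   = p ∷ []
  pointsTos (prd _)   = []
  pointsTos (Σ₁ ∗ Σ₂) = pointsTos Σ₁ ++ pointsTos Σ₂

  predAtoms : ∀ {Γ} → Spatial Γ → List (PredAtom Γ)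
  predAtoms emp       = []
  predAtoms (pto _)   = []
  predAtoms (prd a)   = a ∷ []
  predAtoms (Σ₁ ∗ Σ₂) = predAtoms Σ₁ ++ predAtoms Σ₂

  Var : Ctx → Set
  Var Γ = ∃ λ σ → σ ∈ Γ

  varsTerm : ∀ {Γ σ} → Term Γ σ → List (Var Γ)
  varsTerm (var x) = (_ , x) ∷ []
  varsTerm nil     = []

  varsLiteral : ∀ {Γ} → Literal Γ → List (Var Γ)
  varsLiteral (E ≐ F)    = varsTerm E ++ varsTerm F
  varsLiteral (E ≠ F)    = varsTerm E ++ varsTerm F
  varsLiteral (con _ xs) = All.reduce (λ x → _ , x) xs

  varsPointsTo : ∀ {Γ} → PointsTo Γ → List (Var Γ)
  varsPointsTo (E ↦ ρ) = (_ , E) ∷ concatMap (λ (_ , t) → varsTerm t) ρ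

  varsPredAtom : ∀ {Γ} → PredAtom Γ → List (Var Γ)
  varsPredAtom (_ ⟨ ts ⟩) = List.concat (All.reduce varsTerm ts)

  record Rule (Q : Pred) : Set where
    constructor rule
    field
      locals : Ctx
      pure   : Pure (params Q ++ locals)
      body   : Spatial (params Q ++ locals)
  open Rule public

  IsBase : ∀ {Q} → Rule Q → Set
  IsBase r = predAtoms (body r) ≡ []

  IsInductive : ∀ {Q} → Rule Q → Set
  IsInductive r = ¬ IsBase r

  -- The Gaifman graph of a separating conjunction of points-to atoms, on
  -- location terms; nil can only occur in it as a vertex without outgoing arcs.
  module Gaifman {Γ : Ctx} (ps : List (PointsTo Γ)) where

    _⟶_ : Term Γ loc → Term Γ loc → Set
    X ⟶ Y = Any (λ p → X ≡ var (source p) × (∃ λ f → (inj₁ f , Y) ∈ cells p)) ps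

    Vertex : Term Γ loc → Set
    Vertex X = Any (λ p → X ≡ var (source p) ⊎ (∃ λ f → (inj₁ f , X) ∈ cells p)) ps

    Leaf : Term Γ loc → Set
    Leaf X = Vertex X × (∀ Y → ¬ (X ⟶ Y))

    Connected : Set
    Connected = ∀ {X Y} → Vertex X → Vertex Y → EqClosure _⟶_ X Y

    Acyclic : Set
    Acyclic = ∀ {X} → ¬ TransClosure _⟶_ X X

    AllReachableFrom : Term Γ loc → Set
    AllReachableFrom E = ∀ {X} → Vertex X → Star _⟶_ E X

  record WellRooted {Q : Pred} (r : Rule Q) : Set where
    Σ₁ : List (PointsTo (params Q ++ locals r))
    Σ₁ = pointsTos (body r)

    Σ₂ : List (PredAtom (params Q ++ locals r))
    Σ₂ = predAtoms (body r)

    root : loc ∈ params Q ++ locals r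
    root = here refl

    open Gaifman Σ₁

    field
      uniqueRoot : ∃! _≡_ λ (i : Fin (length Σ₁)) → source (List.lookup Σ₁ i) ≡ root
      allLocals  : (Z : loc ∈ locals r) → Vertex (var (∈-++⁺ʳ (params Q) Z))
      connected  : Connected
      acyclic    : Acyclic
      reachable  : AllReachableFrom (var root)
      leaves     : All (λ a → Leaf (All.head (args a))) Σ₂

  record Definitions : Set where
    field
      rules      : (Q : Pred) → List (Rule Q)
      wellRooted : ∀ {Q} {r : Rule Q} → r ∈ rules Q → IsInductive r → WellRooted r

  evalTerm : ∀ {Γ σ} → Stack Γ → Term Γ σ → Val σ
  evalTerm s (var x) = All.lookup s x
  evalTerm s nil     = nilₗ

  _⊨ˡ_ : ∀ {Γ} → Stack Γ → Literal Γ → Set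
  s ⊨ˡ (E ≐ F)    = evalTerm s E ≡ evalTerm s F
  s ⊨ˡ (E ≠ F)    = evalTerm s E ≢ evalTerm s F
  s ⊨ˡ (con c xs) = All.map (All.lookup s) xs ⊨ᵈ c

  _⊨ᵖ_ : ∀ {Γ} → Stack Γ → Pure Γ → Set
  s ⊨ᵖ Π = All (s ⊨ˡ_) Π

  record _,_⊨↦_ {Γ} (s : Stack Γ) (h : Heap) (p : PointsTo Γ) : Set where
    field
      contents : All (λ (f , t) → at h (All.lookup s (source p)) f ≡ just (evalTerm s t))
                     (cells p)
      exact    : ∀ ℓ f → Is-just (at h ℓ f) →
                 ℓ ≡ All.lookup s (source p) × f ∈ List.map proj₁ (cells p)

  module Semantics (𝒟 : Definitions) where
    open Definitions 𝒟

    -- `Holds Q v h` is the least family of relations closed under the rules;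
    -- v gives the values of the parameters of Q.
    data Holds (Q : Pred) : Stack (params Q) → Heap → Set
    data _,_⊨ˢ_ {Γ : Ctx} (s : Stack Γ) (h : Heap) : Spatial Γ → Set

    data Holds Q where
      unfold : ∀ {v h} {r : Rule Q} → r ∈ rules Q → (z : Stack (locals r)) →
               All.++⁺ v z ⊨ᵖ pure r → All.++⁺ v z , h ⊨ˢ body r → Holds Q v h

    data _,_⊨ˢ_ {Γ} s h where
      emp : IsEmpty h → s , h ⊨ˢ emp
      pto : ∀ {p} → s , h ⊨↦ p → s , h ⊨ˢ pto p
      prd : ∀ {a} → Holds (name a) (All.map (evalTerm s) (args a)) h → s , h ⊨ˢ prd a
      sep : ∀ {Σ₁ Σ₂ h₁ h₂} → Split h h₁ h₂ →
            s , h₁ ⊨ˢ Σ₁ → s , h₂ ⊨ˢ Σ₂ → s , h ⊨ˢ (Σ₁ ∗ Σ₂)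

    _,_⊨_ : ∀ {Γ} → Stack Γ → Heap → Formula Γ → Set
    s , h ⊨ (Π ∧ A)  = s ⊨ᵖ Π × s , h ⊨ˢ A
    s , h ⊨ (φ ∨ ψ)  = (s , h ⊨ φ) ⊎ (s , h ⊨ ψ)
    s , h ⊨ (ex σ φ) = Σ (Val σ) λ v → (v ∷ s) , h ⊨ φ

    _⇛_ : ∀ {Γ} → Formula Γ → Formula Γ → Set
    φ ⇛ ψ = ∀ s h → s , h ⊨ φ → s , h ⊨ ψ

  -- The division of the parameters of P into (α₁ , α₂), (β₁ , β₂) and ξ.
  record Compositional-Parameters (P : Pred) : Set where
    field
      δ     : DataSort
      Ξ     : List Sort
      shape : rest P ≡ dat δ ∷ loc ∷ dat δ ∷ Ξ

    ⟪_,_,_,_,_⟫ : ∀ {F : Sort → Set} →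
                  F loc → F (dat δ) → F loc → F (dat δ) → All F Ξ → All F (params P)
    ⟪_,_,_,_,_⟫ {F} a₁ a₂ b₁ b₂ xs =
      a₁ ∷ subst (All F) (sym shape) (a₂ ∷ b₁ ∷ b₂ ∷ xs)

    parameter : ∀ {σ} → σ ∈ dat δ ∷ loc ∷ dat δ ∷ Ξ → σ ∈ params P
    parameter x = there (subst (_ ∈_) (sym shape) x)

    α₁ : loc ∈ params P
    α₁ = here refl

    α₂ : dat δ ∈ params P
    α₂ = parameter (here refl)

    β₁ : loc ∈ params P
    β₁ = parameter (there (here refl))

    β₂ : dat δ ∈ params P
    β₂ = parameter (there (there (here refl)))

    ξ : All (_∈ params P) Ξ
    ξ = All.tabulate λ x → parameter (there (there (there x)))

  module Compositionality {P : Pred} (D : Compositional-Parameters P) where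
    open Compositional-Parameters D

    baseRule : Rule P
    baseRule = rule []
      ( (var (∈-++⁺ˡ α₁) ≐ var (∈-++⁺ˡ β₁))
      ∷ con (equal δ) (∈-++⁺ˡ α₂ ∷ ∈-++⁺ˡ β₂ ∷ [])
      ∷ [] )
      emp

    -- Spatial formulas are read up to associativity and commutativity of ∗,
    -- with unit emp.
    record CompositionalRule (r : Rule P) : Set where
      Γ : Ctx
      Γ = params P ++ locals r

      param : ∀ {σ} → σ ∈ params P → σ ∈ Γ
      param = ∈-++⁺ˡ

      local : ∀ {σ} → σ ∈ locals r → σ ∈ Γ
      local = ∈-++⁺ʳ (params P)

      Fresh : List (Var Γ) → Set
      Fresh xs = (_ , param β₁) ∉ xs × (_ , param β₂) ∉ xs

      field
        γ₁       : loc ∈ locals r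
        γ₂       : dat δ ∈ locals r
        Σ₂       : List (PredAtom Γ)
        form     : predAtoms (body r) ↭
                     P ⟨ ⟪ var (local γ₁) , var (local γ₂)
                         , var (param β₁) , var (param β₂)
                         , All.map (λ x → var (param x)) ξ ⟫ ⟩ ∷ Σ₂
        nonempty : pointsTos (body r) ≢ []
        fresh-Π  : Fresh (concatMap varsLiteral (pure r))
        fresh-Σ₁ : Fresh (concatMap varsPointsTo (pointsTos (body r)))
        fresh-Σ₂ : Fresh (concatMap varsPredAtom Σ₂)
        fresh-γ  : Fresh ((_ , local γ₁) ∷ (_ , local γ₂) ∷ [])

    record SyntacticallyCompositional (𝒟 : Definitions) : Set where
      open Definitions 𝒟
      field
        base           : baseRule ∈ rules P
        base-unique    : ∀ {r} → r ∈ rules P → IsBase r → r ≡ baseRule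
        some-inductive : ∃ λ r → r ∈ rules P × IsInductive r
        all-inductive  : ∀ {r} → r ∈ rules P → IsInductive r → CompositionalRule r

    -- α and ξ are read as arbitrary variables of Γ; the bound variables β are
    -- the two newest ones (β₁ outermost), so they cannot capture γ.
    SemanticallyCompositional : Definitions → Set
    SemanticallyCompositional 𝒟 =
      ∀ {Γ} (α₁ : loc ∈ Γ) (α₂ : dat δ ∈ Γ) (ξ : All (_∈ Γ) Ξ)
            (γ₁ : loc ∈ Γ) (γ₂ : dat δ ∈ Γ) →
      let
        b₁ : Term (dat δ ∷ loc ∷ Γ) loc
        b₁ = var (there (here refl))

        b₂ : Term (dat δ ∷ loc ∷ Γ) (dat δ)
        b₂ = var (here refl)

        old : ∀ {σ} → σ ∈ Γ → Term (dat δ ∷ loc ∷ Γ) σ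
        old x = var (there (there x))
      in
      ex loc (ex (dat δ)
        ([] ∧ (prd (P ⟨ ⟪ old α₁ , old α₂ , b₁ , b₂ , All.map old ξ ⟫ ⟩)
             ∗ prd (P ⟨ ⟪ b₁ , b₂ , old γ₁ , old γ₂ , All.map old ξ ⟫ ⟩))))
      ⇛
      ([] ∧ prd (P ⟨ ⟪ var α₁ , var α₂ , var γ₁ , var γ₂ , All.map var ξ ⟫ ⟩))
      where open Semantics 𝒟

{-# OPTIONS --safe #-}

-- Induction on the derivation of P(α, β, ξ).  At the base rule α = β and the
-- heap is empty.  At an inductive rule, the variables β occur in the body only
-- in the recursive atom P(γ, β, ξ): replacing their values by those of the new
-- holes preserves every other conjunct, and the induction hypothesis lets the
-- recursive atom absorb the heap of the second factor.
module Submission where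

open import Defs

open import Data.Empty using (⊥-elim)
open import Data.List using (List; []; _∷_; _++_; concatMap)
import Data.List as List
open import Data.List.Membership.Propositional using (_∈_; _∉_)
open import Data.List.Membership.Propositional.Properties using (∈-++⁺ˡ; ∈-++⁺ʳ)
open import Data.List.Relation.Binary.Permutation.Propositional as Perm using (_↭_; ↭-sym)
open import Data.List.Relation.Binary.Permutation.Propositional.Properties using (All-resp-↭)
open import Data.List.Relation.Unary.All as All using (All; []; _∷_)
import Data.List.Relation.Unary.All.Properties as All
open import Data.List.Relation.Unary.Any using (here; there)
open import Data.Maybe using (Maybe; just; nothing; Is-just; _<∣>_)
import Data.Maybe.Relation.Unary.Any as Maybe
open import Data.Maybe.Properties using (<∣>-assoc; <∣>-identityʳ)
open import Data.Product using (_×_; _,_; proj₁; proj₂)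
open import Data.Sum using (_⊎_; inj₁; inj₂; [_,_]; map)
open import Data.Unit using (tt)
open import Function using (_∘_)
open import Function.Bundles using (Equivalence)
open import Relation.Binary.PropositionalEquality
  using (_≡_; _≢_; refl; sym; trans; cong; cong₂; subst; subst₂; module ≡-Reasoning)
open import Relation.Nullary using (¬_)

-- Lists with one distinguished entry, and lookup in concatenated stacks.

module _ {A : Set} where

  -- The distinguished entry is tracked by its occurrence. `T` will single out the recursive atom of
  -- a rule and `R` will say that the other predicate atoms, possibly also `P` atoms, do not feel
  -- the change of holes.
  data ExactlyOne (T R : A → Set) : List A → Set where
    here  : ∀ {x xs} → T x → All R xs → ExactlyOne T R (x ∷ xs)
    there : ∀ {x xs} → R x → ExactlyOne T R xs → ExactlyOne T R (x ∷ xs)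

  module _ {T R : A → Set} where

    ExactlyOne-resp-↭ : ∀ {xs ys} → xs ↭ ys → ExactlyOne T R xs → ExactlyOne T R ys
    ExactlyOne-resp-↭ Perm.refl o = o
    ExactlyOne-resp-↭ (Perm.prep x p) (here t rs) = here t (All-resp-↭ p rs)
    ExactlyOne-resp-↭ (Perm.prep x p) (there r o) = there r (ExactlyOne-resp-↭ p o)
    ExactlyOne-resp-↭ (Perm.swap x y p) (here t (r ∷ rs)) = there r (here t (All-resp-↭ p rs))
    ExactlyOne-resp-↭ (Perm.swap x y p) (there r (here t rs)) = here t (r ∷ All-resp-↭ p rs)
    ExactlyOne-resp-↭ (Perm.swap x y p) (there r (there r′ o)) = there r′ (there r (ExactlyOne-resp-↭ p o))
    ExactlyOne-resp-↭ (Perm.trans p q) o = ExactlyOne-resp-↭ q (ExactlyOne-resp-↭ p o)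

    -- Tells which side of a `∗` contains the recursive atom, since `predAtoms` sends `∗` to `++`.
    ExactlyOne-++⁻ : ∀ xs {ys} → ExactlyOne T R (xs ++ ys) →
                     (ExactlyOne T R xs × All R ys) ⊎ (All R xs × ExactlyOne T R ys)
    ExactlyOne-++⁻ []       o           = inj₂ ([] , o)
    ExactlyOne-++⁻ (x ∷ xs) (here t rs) = inj₁ (here t (All.++⁻ˡ xs rs) , All.++⁻ʳ xs rs)
    ExactlyOne-++⁻ (x ∷ xs) (there r o) =
      map (λ (o , rs) → there r o , rs) (λ (rs , o) → r ∷ rs , o) (ExactlyOne-++⁻ xs o)

module _ {A : Set} {F : A → Set} where

  lookup-++⁺ˡ : ∀ {xs ys x} (v : All F xs) (w : All F ys) (i : x ∈ xs) →
                All.lookup (All.++⁺ v w) (∈-++⁺ˡ i) ≡ All.lookup v i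
  lookup-++⁺ˡ (_ ∷ _) w (here refl) = refl
  lookup-++⁺ˡ (_ ∷ v) w (there i)   = lookup-++⁺ˡ v w i

  lookup-++⁺ʳ : ∀ {xs ys x} (v : All F xs) (w : All F ys) (i : x ∈ ys) →
                All.lookup (All.++⁺ v w) (∈-++⁺ʳ xs i) ≡ All.lookup w i
  lookup-++⁺ʳ []      w i = refl
  lookup-++⁺ʳ (_ ∷ v) w i = lookup-++⁺ʳ v w i

  map-tabulate-≡ : ∀ {G : A → Set} {xs} {f : ∀ {x} → G x → F x} {g : ∀ {x} → x ∈ xs → G x}
                   (v : All F xs) → (∀ {x} (i : x ∈ xs) → f (g i) ≡ All.lookup v i) →
                   All.map f (All.tabulate g) ≡ v
  map-tabulate-≡ []      eq = refl
  map-tabulate-≡ (a ∷ v) eq = cong₂ _∷_ (eq (here refl)) (map-tabulate-≡ v (eq ∘ there))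

-- Algebra of heaps and their splittings.

module Heaps (V : Vocabulary) where
  open Vocabulary V

  infix 4 _≈_

  -- Heaps also carry a list covering their domain, so heaps with the same cells need not be
  -- propositionally equal.
  _≈_ : Heap → Heap → Set
  h ≈ h′ = ∀ ℓ f → at h ℓ f ≡ at h′ ℓ f

  Split-resp-≈ : ∀ {h h′ h₁ h₂} → h ≈ h′ → Split h h₁ h₂ → Split h′ h₁ h₂
  Split-resp-≈ eq sp = record
    { disjoint = Split.disjoint sp
    ; union    = λ ℓ f → trans (sym (eq ℓ f)) (Split.union sp ℓ f) }

  Split-emptyˡ : ∀ {h h₁ h₂} → IsEmpty h₁ → Split h h₁ h₂ → h₂ ≈ h
  Split-emptyˡ {h₂ = h₂} e sp ℓ f =
    sym (trans (Split.union sp ℓ f) (cong (_<∣> at h₂ ℓ f) (e ℓ f)))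

  module _ {A : Set} where

    Is-just-<∣>⁻ : (x y : Maybe A) → Is-just (x <∣> y) → Is-just x ⊎ Is-just y
    Is-just-<∣>⁻ (just _) y j = inj₁ (Maybe.just tt)
    Is-just-<∣>⁻ nothing  y j = inj₂ j

    Is-just-<∣>⁺ˡ : (x y : Maybe A) → Is-just x → Is-just (x <∣> y)
    Is-just-<∣>⁺ˡ (just _) y j = Maybe.just tt

    Is-just-<∣>⁺ʳ : (x y : Maybe A) → Is-just y → Is-just (x <∣> y)
    Is-just-<∣>⁺ʳ (just _) y j = Maybe.just tt
    Is-just-<∣>⁺ʳ nothing  y j = j

    <∣>-comm : (x y : Maybe A) → ¬ (Is-just x × Is-just y) → x <∣> y ≡ y <∣> x
    <∣>-comm (just _) (just _) d = ⊥-elim (d (Maybe.just tt , Maybe.just tt))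
    <∣>-comm (just _) nothing  d = refl
    <∣>-comm nothing  y        d = sym (<∣>-identityʳ y)

  _∪_ : Heap → Heap → Heap
  h₁ ∪ h₂ = record
    { at     = λ ℓ f → at h₁ ℓ f <∣> at h₂ ℓ f
    ; finite = proj₁ (finite h₁) ++ proj₁ (finite h₂) , λ {ℓ} {f} j →
        [ ∈-++⁺ˡ ∘ proj₂ (finite h₁)
                 , ∈-++⁺ʳ (proj₁ (finite h₁)) ∘ proj₂ (finite h₂) ]
          (Is-just-<∣>⁻ (at h₁ ℓ f) (at h₂ ℓ f) j) }

  Split-∪ : ∀ {h₁ h₂} → (∀ ℓ f → ¬ (Is-just (at h₁ ℓ f) × Is-just (at h₂ ℓ f))) →
            Split (h₁ ∪ h₂) h₁ h₂
  Split-∪ d = record { disjoint = d ; union = λ ℓ f → refl }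

  Split-comm : ∀ {h h₁ h₂} → Split h h₁ h₂ → Split h h₂ h₁
  Split-comm {h₁ = h₁} {h₂} sp = record
    { disjoint = λ ℓ f (j₂ , j₁) → disjoint ℓ f (j₁ , j₂)
    ; union    = λ ℓ f → trans (union ℓ f) (<∣>-comm (at h₁ ℓ f) (at h₂ ℓ f) (disjoint ℓ f)) }
    where open Split sp

  -- `hᵣ ∪ h₂` is the heap on which the conjunct containing the recursive atom will hold after
  -- absorbing the second factor's heap `h₂`.
  Split-assoc : ∀ {h h₁ h₂ hₗ hᵣ} → Split h h₁ h₂ → Split h₁ hₗ hᵣ →
                Split h hₗ (hᵣ ∪ h₂) × Split (hᵣ ∪ h₂) hᵣ h₂
  Split-assoc {h} {h₁} {h₂} {hₗ} {hᵣ} sp sp₁ =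
    record
      { disjoint = λ ℓ f (jₗ , j) → [ (λ jᵣ → Split.disjoint sp₁ ℓ f (jₗ , jᵣ))
          , (λ j₂ → Split.disjoint sp ℓ f
              (subst Is-just (sym (Split.union sp₁ ℓ f)) (Is-just-<∣>⁺ˡ (at hₗ ℓ f) (at hᵣ ℓ f) jₗ) , j₂)) ]
          (Is-just-<∣>⁻ (at hᵣ ℓ f) (at h₂ ℓ f) j)
      ; union = λ ℓ f → trans (Split.union sp ℓ f)
          (trans (cong (_<∣> at h₂ ℓ f) (Split.union sp₁ ℓ f))
                 (<∣>-assoc (at hₗ ℓ f) (at hᵣ ℓ f) (at h₂ ℓ f))) }
    , Split-∪ λ ℓ f (jᵣ , j₂) → Split.disjoint sp ℓ f
        (subst Is-just (sym (Split.union sp₁ ℓ f)) (Is-just-<∣>⁺ʳ (at hₗ ℓ f) (at hᵣ ℓ f) jᵣ) , j₂)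

-- Invariance of satisfaction under agreeing stacks and equal heaps.

module Agreement (V : Vocabulary) (S : PredicateSignature V) where
  open Vocabulary V
  open PredicateSignature S
  open Logic V S
  open Heaps V

  -- A record, so that the stacks can be inferred from the type.
  record SameValue {Γ} (s s′ : Stack Γ) (x : Var Γ) : Set where
    constructor same
    field
      value : All.lookup s (proj₂ x) ≡ All.lookup s′ (proj₂ x)

  Agree : ∀ {Γ} → Stack Γ → Stack Γ → List (Var Γ) → Set
  Agree s s′ = All (SameValue s s′)

  module _ {Γ} {s s′ : Stack Γ} where

    Agree-concatMap⁻ : ∀ {A : Set} (f : A → List (Var Γ)) {ys} →
                       Agree s s′ (concatMap f ys) → All (Agree s s′ ∘ f) ys
    Agree-concatMap⁻ f eqs = All.map⁻ (All.concat⁻ eqs)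

    evalTerm-agree : ∀ {σ} (t : Term Γ σ) → Agree s s′ (varsTerm t) →
                     evalTerm s t ≡ evalTerm s′ t
    evalTerm-agree (var x) (same eq ∷ []) = eq
    evalTerm-agree nil     []        = refl

    evalTerms-agree : ∀ {σs} (ts : All (Term Γ) σs) →
                      Agree s s′ (List.concat (All.reduce varsTerm ts)) →
                      All.map (evalTerm s) ts ≡ All.map (evalTerm s′) ts
    evalTerms-agree []       eqs = refl
    evalTerms-agree (t ∷ ts) eqs =
      cong₂ _∷_ (evalTerm-agree t (All.++⁻ˡ (varsTerm t) eqs))
                (evalTerms-agree ts (All.++⁻ʳ (varsTerm t) eqs))

    lookups-agree : ∀ {Δ} (xs : All (λ δ → dat δ ∈ Γ) Δ) →
                    Agree s s′ (All.reduce (λ x → _ , x) xs) →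
                    All.map {Q = Value} (All.lookup s) xs ≡ All.map (All.lookup s′) xs
    lookups-agree []       []         = refl
    lookups-agree (x ∷ xs) (same eq ∷ eqs) = cong₂ _∷_ eq (lookups-agree xs eqs)

    ⊨ˡ-agree : ∀ L → Agree s s′ (varsLiteral L) → s ⊨ˡ L → s′ ⊨ˡ L
    ⊨ˡ-agree (E ≐ F) eqs =
      subst₂ _≡_ (evalTerm-agree E (All.++⁻ˡ (varsTerm E) eqs))
                 (evalTerm-agree F (All.++⁻ʳ (varsTerm E) eqs))
    ⊨ˡ-agree (E ≠ F) eqs =
      subst₂ _≢_ (evalTerm-agree E (All.++⁻ˡ (varsTerm E) eqs))
                 (evalTerm-agree F (All.++⁻ʳ (varsTerm E) eqs))
    ⊨ˡ-agree (con c xs) eqs = subst (_⊨ᵈ c) (lookups-agree xs eqs)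

    ⊨ᵖ-agree : ∀ {Π} → Agree s s′ (concatMap varsLiteral Π) → s ⊨ᵖ Π → s′ ⊨ᵖ Π
    ⊨ᵖ-agree eqs p =
      All.zipWith (λ {L} (eq , l) → ⊨ˡ-agree L eq l) (Agree-concatMap⁻ varsLiteral eqs , p)

    ⊨↦-agree : ∀ {h p} → Agree s s′ (varsPointsTo p) → s , h ⊨↦ p → s′ , h ⊨↦ p
    ⊨↦-agree {h} {E ↦ ρ} (same eq ∷ eqs) sat = record
      { contents = All.zipWith
          (λ {(f , t)} (eqt , c) →
            trans (cong (λ ℓ → at h ℓ f) (sym eq)) (trans c (cong just (evalTerm-agree t eqt))))
          (Agree-concatMap⁻ (λ (_ , t) → varsTerm t) eqs , _,_⊨↦_.contents sat)
      ; exact = λ ℓ f j → let ℓ≡ , f∈ = _,_⊨↦_.exact sat ℓ f j in trans ℓ≡ eq , f∈ }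

  ⊨↦-resp-≈ : ∀ {Γ} {s : Stack Γ} {h h′ p} → h ≈ h′ → s , h ⊨↦ p → s , h′ ⊨↦ p
  ⊨↦-resp-≈ eq sat = record
    { contents = All.map (trans (sym (eq _ _))) (_,_⊨↦_.contents sat)
    ; exact    = λ ℓ f j → _,_⊨↦_.exact sat ℓ f (subst Is-just (sym (eq ℓ f)) j) }

  module _ (𝒟 : Definitions) where
    open Semantics 𝒟

    -- `Holds` depends on the stack only through the values of the arguments, so a predicate atom is
    -- transferred without entering its derivation.
    ⊨ˢ-agree : ∀ {Γ} {s s′ : Stack Γ} {h A} →
               All (Agree s s′ ∘ varsPointsTo) (pointsTos A) →
               All (Agree s s′ ∘ varsPredAtom) (predAtoms A) →
               s , h ⊨ˢ A → s′ , h ⊨ˢ A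
    ⊨ˢ-agree _ _ (emp e) = emp e
    ⊨ˢ-agree (eqs ∷ []) _ (pto sat) = pto (⊨↦-agree eqs sat)
    ⊨ˢ-agree {h = h} _ (eqs ∷ []) (prd {a} q) =
      prd (subst (λ v → Holds (name a) v h) (evalTerms-agree (args a) eqs) q)
    ⊨ˢ-agree ps qs (sep {Σ₁} sp l r) =
      sep sp (⊨ˢ-agree (All.++⁻ˡ (pointsTos Σ₁) ps) (All.++⁻ˡ (predAtoms Σ₁) qs) l)
             (⊨ˢ-agree (All.++⁻ʳ (pointsTos Σ₁) ps) (All.++⁻ʳ (predAtoms Σ₁) qs) r)

    mutual
      -- Serves the base rule, where the composed heap has the same cells as the second factor's
      -- heap.
      Holds-resp-≈ : ∀ {Q v h h′} → h ≈ h′ → Holds Q v h → Holds Q v h′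
      Holds-resp-≈ eq (unfold r∈ z p b) = unfold r∈ z p (⊨ˢ-resp-≈ eq b)

      ⊨ˢ-resp-≈ : ∀ {Γ} {s : Stack Γ} {h h′ A} → h ≈ h′ → s , h ⊨ˢ A → s , h′ ⊨ˢ A
      ⊨ˢ-resp-≈ eq (emp e)      = emp λ ℓ f → trans (sym (eq ℓ f)) (e ℓ f)
      ⊨ˢ-resp-≈ eq (pto sat)    = pto (⊨↦-resp-≈ eq sat)
      ⊨ˢ-resp-≈ eq (prd q)      = prd (Holds-resp-≈ eq q)
      -- Only the whole heap is replaced; both parts are kept, so there is no recursion.
      ⊨ˢ-resp-≈ eq (sep sp l r) = sep (Split-resp-≈ eq sp) l r

-- Evaluation of the parameters of `P`, then the induction.

module Composition (V : Vocabulary) (S : PredicateSignature V) (𝒟 : Logic.Definitions V S)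
    (P : PredicateSignature.Pred S) (D : Logic.Compositional-Parameters V S P) where
  open Vocabulary V
  open PredicateSignature S
  open Logic V S
  open Definitions 𝒟
  open Semantics 𝒟
  open Compositional-Parameters D
  open Compositionality D
  open Heaps V
  open Agreement V S

  -- `rest P` is not a variable, so `shape` cannot be matched with `refl`; the local helper
  -- generalises its two sides to variables first. The next lemmas use the same device.
  map-⟪⟫ : ∀ {F G : Sort → Set} (f : ∀ {σ} → F σ → G σ) a₁ a₂ b₁ b₂ xs →
           All.map f ⟪ a₁ , a₂ , b₁ , b₂ , xs ⟫ ≡
           ⟪_,_,_,_,_⟫ {G} (f a₁) (f a₂) (f b₁) (f b₂) (All.map f xs)
  map-⟪⟫ {F} {G} f a₁ _ _ _ _ = cong (f a₁ ∷_) (map-subst shape)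
    where
    map-subst : ∀ {Θ Θ′} (e : Θ ≡ Θ′) {ys : All F Θ′} →
                All.map f (subst (All F) (sym e) ys) ≡ subst (All G) (sym e) (All.map f ys)
    map-subst refl = refl

  lookup-parameter : ∀ {σ a₁ a₂ b₁ b₂ xs} (x : σ ∈ dat δ ∷ loc ∷ dat δ ∷ Ξ) →
                     All.lookup ⟪ a₁ , a₂ , b₁ , b₂ , xs ⟫ (parameter x) ≡
                     All.lookup {P = Val} (a₂ ∷ b₁ ∷ b₂ ∷ xs) x
  lookup-parameter = lookup-subst shape
    where
    lookup-subst : ∀ {Θ Θ′ σ} (e : Θ ≡ Θ′) {ys : Stack Θ′} (x : σ ∈ Θ′) →
                   All.lookup (subst Stack (sym e) ys) (subst (σ ∈_) (sym e) x) ≡ All.lookup ys x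
    lookup-subst refl x = refl

  agree-off-β : ∀ {L a₁ a₂ b₁ b₂ c₁ c₂ xs} (z : Stack L) {ys : List (Var (params P ++ L))} →
                (_ , ∈-++⁺ˡ β₁) ∉ ys × (_ , ∈-++⁺ˡ β₂) ∉ ys →
                Agree (All.++⁺ ⟪ a₁ , a₂ , b₁ , b₂ , xs ⟫ z)
                      (All.++⁺ ⟪ a₁ , a₂ , c₁ , c₂ , xs ⟫ z) ys
  agree-off-β {L} {a₁} z {ys} (β₁∉ , β₂∉) = All.tabulate λ {(σ , x)} x∈ →
    same (go shape x (λ { refl → β₁∉ x∈ }) (λ { refl → β₂∉ x∈ }))
    where
    -- Once `e` is `refl`, variables are checked by position: only the third and fourth, `β₁` and
    -- `β₂`, can change value, and freshness excludes them.
    go : ∀ {Θ σ a₂ b₁ b₂ c₁ c₂ xs} (e : Θ ≡ dat δ ∷ loc ∷ dat δ ∷ Ξ) (x : σ ∈ (loc ∷ Θ) ++ L) →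
         _≢_ {A = Var ((loc ∷ Θ) ++ L)} (σ , x)
           (loc , ∈-++⁺ˡ (there (subst (loc ∈_) (sym e) (there (here refl))))) →
         _≢_ {A = Var ((loc ∷ Θ) ++ L)} (σ , x)
           (dat δ , ∈-++⁺ˡ (there (subst (dat δ ∈_) (sym e) (there (there (here refl)))))) →
         All.lookup (All.++⁺ (a₁ ∷ subst Stack (sym e) (a₂ ∷ b₁ ∷ b₂ ∷ xs)) z) x ≡
         All.lookup (All.++⁺ (a₁ ∷ subst Stack (sym e) (a₂ ∷ c₁ ∷ c₂ ∷ xs)) z) x
    go refl (here refl)                         n₁ n₂ = refl
    go refl (there (here refl))                 n₁ n₂ = refl
    go refl (there (there (here refl)))         n₁ n₂ = ⊥-elim (n₁ refl)
    go refl (there (there (there (here refl)))) n₁ n₂ = ⊥-elim (n₂ refl)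
    go refl (there (there (there (there x))))   n₁ n₂ = refl

  tailAtom : ∀ {L} → loc ∈ L → dat δ ∈ L → PredAtom (params P ++ L)
  tailAtom γ₁ γ₂ =
    P ⟨ ⟪ var (∈-++⁺ʳ (params P) γ₁) , var (∈-++⁺ʳ (params P) γ₂)
        , var (∈-++⁺ˡ β₁) , var (∈-++⁺ˡ β₂) , All.map (λ x → var (∈-++⁺ˡ x)) ξ ⟫ ⟩

  -- The recursive atom passes holes and static parameters on unchanged. Hence replacing the holes
  -- in the stack replaces exactly the holes of the recursive instance, as the induction hypothesis
  -- requires.
  eval-tailAtom : ∀ {L a₁ a₂ b₁ b₂ xs} (z : Stack L) (γ₁ : loc ∈ L) (γ₂ : dat δ ∈ L) →
                  All.map (evalTerm (All.++⁺ ⟪ a₁ , a₂ , b₁ , b₂ , xs ⟫ z)) (args (tailAtom γ₁ γ₂)) ≡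
                  ⟪ All.lookup z γ₁ , All.lookup z γ₂ , b₁ , b₂ , xs ⟫
  eval-tailAtom {L} {a₁} {a₂} {b₁} {b₂} {xs} z γ₁ γ₂
    rewrite map-⟪⟫ (evalTerm (All.++⁺ ⟪ a₁ , a₂ , b₁ , b₂ , xs ⟫ z))
              (var (∈-++⁺ʳ (params P) γ₁)) (var (∈-++⁺ʳ (params P) γ₂))
              (var (∈-++⁺ˡ β₁)) (var (∈-++⁺ˡ β₂)) (All.map (λ x → var (∈-++⁺ˡ x)) ξ)
          | lookup-++⁺ʳ ⟪ a₁ , a₂ , b₁ , b₂ , xs ⟫ z γ₁
          | lookup-++⁺ʳ ⟪ a₁ , a₂ , b₁ , b₂ , xs ⟫ z γ₂
          | lookup-++⁺ˡ ⟪ a₁ , a₂ , b₁ , b₂ , xs ⟫ z β₁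
          | lookup-++⁺ˡ ⟪ a₁ , a₂ , b₁ , b₂ , xs ⟫ z β₂
          | lookup-parameter {a₁ = a₁} {a₂} {b₁} {b₂} {xs} (there (here refl))
          | lookup-parameter {a₁ = a₁} {a₂} {b₁} {b₂} {xs} (there (there (here refl)))
    = cong ⟪ _ , _ , b₁ , b₂ ,_⟫ static
    where
    v : Stack (params P)
    v = ⟪ a₁ , a₂ , b₁ , b₂ , xs ⟫

    static : All.map (evalTerm (All.++⁺ v z)) (All.map (λ x → var (∈-++⁺ˡ x)) ξ) ≡ xs
    static = begin
      All.map (evalTerm (All.++⁺ v z)) (All.map (λ x → var (∈-++⁺ˡ x)) ξ)
        ≡⟨ All.map-∘ ξ ⟩
      All.map (λ x → All.lookup (All.++⁺ v z) (∈-++⁺ˡ x)) ξ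
        ≡⟨ map-tabulate-≡ xs (λ x →
             trans (lookup-++⁺ˡ v z (parameter (there (there (there x)))))
                   (lookup-parameter {a₁ = a₁} {xs = xs} (there (there (there x))))) ⟩
      xs ∎
      where open ≡-Reasoning

  base? : (r : Rule P) → IsBase r ⊎ IsInductive r
  base? r with predAtoms (body r)
  ... | []    = inj₁ refl
  ... | _ ∷ _ = inj₂ λ ()

  module _ (sc : SyntacticallyCompositional 𝒟) where
    open SyntacticallyCompositional sc

    mutual
      -- The values `v` are tied to their tuple by an equation because the recursive atom supplies
      -- them as an evaluated argument list: transporting its derivation by `subst` would hide that
      -- it is structurally smaller.
      compose : ∀ {a₁ a₂ b₁ b₂ c₁ c₂ xs v h h₁ h₂} → v ≡ ⟪ a₁ , a₂ , b₁ , b₂ , xs ⟫ →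
                Holds P v h₁ → Holds P ⟪ b₁ , b₂ , c₁ , c₂ , xs ⟫ h₂ → Split h h₁ h₂ →
                Holds P ⟪ a₁ , a₂ , c₁ , c₂ , xs ⟫ h
      compose {a₁} {a₂} {b₁} {b₂} {c₁} {c₂} {xs} {h = h} refl (unfold {r = r} r∈ z p b) q sp
        with base? r
      ... | inj₁ base with base-unique r∈ base
      compose {a₁} {a₂} {b₁} {b₂} {c₁} {c₂} {xs} {h = h} refl (unfold r∈ [] (e₁ ∷ e₂ ∷ []) (emp e)) q sp
          | inj₁ base | refl =
        subst₂ (λ x y → Holds P ⟪ x , y , c₁ , c₂ , xs ⟫ h) (sym a₁≡b₁) (sym a₂≡b₂)
          (Holds-resp-≈ 𝒟 (Split-emptyˡ e sp) q)
        where
        v : Stack (params P)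
        v = ⟪ a₁ , a₂ , b₁ , b₂ , xs ⟫

        lookup-param : ∀ {σ} (x : σ ∈ dat δ ∷ loc ∷ dat δ ∷ Ξ) →
                       All.lookup (All.++⁺ v []) (∈-++⁺ˡ (parameter x)) ≡
                       All.lookup {P = Val} (a₂ ∷ b₁ ∷ b₂ ∷ xs) x
        lookup-param x = trans (lookup-++⁺ˡ v [] (parameter x)) (lookup-parameter {a₁ = a₁} x)

        a₁≡b₁ : a₁ ≡ b₁
        -- The left side of `e₁` computes to `a₁`, because `α₁` lies outside the transport along
        -- `shape`; `α₂` lies inside it.
        a₁≡b₁ = trans e₁ (lookup-param (there (here refl)))

        a₂≡b₂ : a₂ ≡ b₂
        a₂≡b₂ = trans (sym (lookup-param (here refl)))
                  (trans (Equivalence.to equal-⇔ e₂) (lookup-param (there (there (here refl)))))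
      compose refl (unfold r∈ z p b) q sp | inj₂ ind =
        -- The same rule is applied with the same local values `z`; only the hole values differ.
        unfold r∈ z (⊨ᵖ-agree (agree-off-β z fresh-Π) p)
          (compose-body γ₁ γ₂
            (Agree-concatMap⁻ varsPointsTo (agree-off-β z fresh-Σ₁))
            -- In the order of `form` the recursive atom comes first; the permutation carries this
            -- to the order of the body.
            (ExactlyOne-resp-↭ (↭-sym form)
              (here refl (Agree-concatMap⁻ varsPredAtom (agree-off-β z fresh-Σ₂))))
            b q sp)
        where open CompositionalRule (all-inductive r∈ ind)

      -- Follows the path to the recursive atom through the tree of `∗`: each conjunct off the path
      -- keeps its heap and is transferred by agreement, while each one on the path gains `h₂`.
      compose-body : ∀ {a₁ a₂ b₁ b₂ c₁ c₂ xs L h h₁ h₂} {z : Stack L} (γ₁ : loc ∈ L) (γ₂ : dat δ ∈ L) →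
        let s  = All.++⁺ ⟪ a₁ , a₂ , b₁ , b₂ , xs ⟫ z
            s′ = All.++⁺ ⟪ a₁ , a₂ , c₁ , c₂ , xs ⟫ z
        in ∀ {A} →
        All (Agree s s′ ∘ varsPointsTo) (pointsTos A) →
        ExactlyOne (_≡ tailAtom γ₁ γ₂) (Agree s s′ ∘ varsPredAtom) (predAtoms A) →
        s , h₁ ⊨ˢ A → Holds P ⟪ b₁ , b₂ , c₁ , c₂ , xs ⟫ h₂ → Split h h₁ h₂ →
        s′ , h ⊨ˢ A
      compose-body {h = h} {z = z} γ₁ γ₂ _ (here refl []) (prd t) q sp =
        prd (subst (λ v → Holds P v h) (sym (eval-tailAtom z γ₁ γ₂))
          (compose (eval-tailAtom z γ₁ γ₂) t q sp))
      compose-body γ₁ γ₂ ps o (sep {Σ₁} sp₁ l r) q sp with ExactlyOne-++⁻ (predAtoms Σ₁) o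
      ... | inj₁ (o₁ , as) =
        -- The left part must meet `h₂`, so the parts are swapped before reassociating and swapped
        -- back in `sep`.
        let sp₂ , sp₃ = Split-assoc sp (Split-comm sp₁) in
        sep (Split-comm sp₂)
          (compose-body γ₁ γ₂ (All.++⁻ˡ (pointsTos Σ₁) ps) o₁ l q sp₃)
          (⊨ˢ-agree 𝒟 (All.++⁻ʳ (pointsTos Σ₁) ps) as r)
      ... | inj₂ (as , o₂) =
        let sp₂ , sp₃ = Split-assoc sp sp₁ in
        sep sp₂
          (⊨ˢ-agree 𝒟 (All.++⁻ˡ (pointsTos Σ₁) ps) as l)
          (compose-body γ₁ γ₂ (All.++⁻ʳ (pointsTos Σ₁) ps) o₂ r q sp₃)

    composition : SemanticallyCompositional 𝒟
    composition α₁ α₂ ξ γ₁ γ₂ s h (w₁ , w₂ , [] , sep {h₁ = h₁} {h₂} sp (prd p) (prd q)) =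
      [] , prd (subst (λ v → Holds P v h) (sym (eval-⟪⟫ s var (var α₁) (var α₂) (var γ₁) (var γ₂)))
        -- Under `s′` a weakened variable computes to its value under `s`, so the two sides match
        -- definitionally. Only `q` is transported, since the induction is on `p`.
        (compose (eval-⟪⟫ s′ old (old α₁) (old α₂) b₁ b₂) p
          (subst (λ v → Holds P v h₂) (eval-⟪⟫ s′ old b₁ b₂ (old γ₁) (old γ₂)) q) sp))
      where
      s′ : Stack _
      s′ = w₂ ∷ w₁ ∷ s

      old : ∀ {σ} → σ ∈ _ → Term (dat δ ∷ loc ∷ _) σ
      old x = var (there (there x))

      b₁ : Term (dat δ ∷ loc ∷ _) loc
      b₁ = var (there (here refl))

      b₂ : Term (dat δ ∷ loc ∷ _) (dat δ)
      b₂ = var (here refl)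

      eval-⟪⟫ : ∀ {Γ′} (t : Stack Γ′) (f : ∀ {σ} → σ ∈ _ → Term Γ′ σ) x₁ x₂ y₁ y₂ →
                All.map (evalTerm t) ⟪ x₁ , x₂ , y₁ , y₂ , All.map f ξ ⟫ ≡
                ⟪ evalTerm t x₁ , evalTerm t x₂ , evalTerm t y₁ , evalTerm t y₂
                , All.map (λ x → evalTerm t (f x)) ξ ⟫
      eval-⟪⟫ t f x₁ x₂ y₁ y₂ =
        trans (map-⟪⟫ (evalTerm t) x₁ x₂ y₁ y₂ (All.map f ξ)) (cong ⟪ _ , _ , _ , _ ,_⟫ (All.map-∘ ξ))

theorem1 : (V : Vocabulary) (S : PredicateSignature V) (𝒟 : Logic.Definitions V S)
    (P : PredicateSignature.Pred S) (D : Logic.Compositional-Parameters V S P) →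
    Logic.Compositionality.SyntacticallyCompositional V S D 𝒟 →
    Logic.Compositionality.SemanticallyCompositional V S D 𝒟
theorem1 = Composition.composition
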